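{- Let $G$ be a group, $X$ a set and $\gamma : X \to G$ such that $X$ generates $G$ with respect to $\gamma$. Let $P_G$ be the $G$-set with underlying set $G$ and action $P_G(g)(z) = gz$, and let $P_X := U P_G$ be the $X$-set with underlying set $G$ and action $P_X(x)(z) = \gamma(x) z$. Then there is a group isomorphism (an equivalence preserving the group structure given by path concatenation) $$\Omega P_G \simeq \Omega P_X,$$ where $\Omega P_G := (P_G = P_G)$ is taken in the type of $G$-sets and $\Omega P_X := (P_X = P_X)$ in the type of $X$-sets.
   Context: Homotopy type theory with univalence. A $G$-set is a set $A$ with an action, i.e. a group morphism $G \to (A \simeq A)$ (equivalently $\alpha : G\to(A\simeq A)$ with $\alpha(xy)=\alpha(x)\circ\alpha(y)$, $\alpha(1)=\mathrm{id}$); $G\text{ - }\mathrm{Set}$ is the type of $G$-sets. An $X$-set is an element of $X\text{ - }\mathrm{Set} := \Sigma(A : \mathrm{Set}).(X \to (A\to A))$. $U : G\text{ - }\mathrm{Set}\to X\text{ - }\mathrm{Set}$ is precomposition by $\gamma$. $\mathrm{F}(X)$ is the free group on $X$, $\tilde\gamma:\mathrm{F}(X)\to G$ the morphism extending $\gamma$, and $X$ generates $G$ when $\tilde\gamma$ is surjective. -}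

{-# OPTIONS --without-K #-}
module Defs where

open import Level using (Level; _⊔_) renaming (suc to lsuc)
open import Data.Product using (Σ; _,_; proj₁; proj₂; _×_; Σ-syntax)
open import Data.List using (List; []; _∷_)
open import Data.Bool using (Bool; true; false)
open import Relation.Binary.PropositionalEquality
  using (_≡_; refl; sym; trans; cong; subst)

private variable
  a b ℓ : Level

isContr : Set a → Set a
isContr A = Σ A (λ c → (x : A) → c ≡ x)

isProp : Set a → Set a
isProp A = (x y : A) → x ≡ y

isSet : Set a → Set a
isSet A = (x y : A) → isProp (x ≡ y)

fiber : {A : Set a} {B : Set b} → (A → B) → B → Set (a ⊔ b)
fiber {A = A} f y = Σ A (λ x → f x ≡ y)

isEquiv : {A : Set a} {B : Set b} → (A → B) → Set (a ⊔ b)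
isEquiv {B = B} f = (y : B) → isContr (fiber f y)

_≃_ : Set a → Set b → Set (a ⊔ b)
A ≃ B = Σ (A → B) isEquiv

idIsEquiv : (A : Set a) → isEquiv (λ (x : A) → x)
idIsEquiv A y = (y , refl) , λ { (x , refl) → refl }

idEquiv : (A : Set a) → A ≃ A
idEquiv A = (λ x → x) , idIsEquiv A

idtoeqv : {A B : Set a} → A ≡ B → A ≃ B
idtoeqv {A = A} refl = idEquiv A

Univalence : (ℓ : Level) → Set (lsuc ℓ)
Univalence ℓ = (A B : Set ℓ) → isEquiv (idtoeqv {A = A} {B = B})

-- (naive, dependent) function extensionality for Set ℓ; a consequence of univalence
FunExt : (ℓ : Level) → Set (lsuc ℓ)
FunExt ℓ = {A : Set ℓ} {B : A → Set ℓ} {f g : (x : A) → B x}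
         → ((x : A) → f x ≡ g x) → f ≡ g

∥_∥ : Set ℓ → Set (lsuc ℓ)
∥_∥ {ℓ} A = (P : Set ℓ) → isProp P → (A → P) → P

isProp→isSet : {A : Set a} → isProp A → isSet A
isProp→isSet {A = A} p x y q r = trans (lem q) (sym (lem r))
  where
  -- g z = p x z ; every path q : x ≡ y equals (g x)⁻¹ · g y
  key : {y : A} (q : x ≡ y) → trans (p x x) q ≡ p x y
  key refl = trans-refl (p x x)
    where
    trans-refl : {u v : A} (s : u ≡ v) → trans s refl ≡ s
    trans-refl refl = refl
  lem : {y : A} (q : x ≡ y) → q ≡ trans (sym (p x x)) (p x y)
  lem {y} q = trans (sym (cancel (p x x) q)) (cong (trans (sym (p x x))) (key q))
    where
    cancel : {u v w : A} (s : u ≡ v) (t : v ≡ w) → trans (sym s) (trans s t) ≡ t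
    cancel refl t = refl

isProp-isContr : {A : Set ℓ} → FunExt ℓ → isProp (isContr A)
isProp-isContr {A = A} fe (c , h) (c' , h') = go (h c') h'
  where
  setA : isSet A
  setA = isProp→isSet (λ x y → trans (sym (h x)) (h y))
  go : (e : c ≡ c') (h'' : (x : A) → c' ≡ x) → (c , h) ≡ (c' , h'')
  go refl h'' = cong (c ,_) (fe (λ x → setA c x (h x) (h'' x)))

isProp-isEquiv : {A B : Set ℓ} → FunExt ℓ → (f : A → B) → isProp (isEquiv f)
isProp-isEquiv fe f p q = fe (λ y → isProp-isContr fe (p y) (q y))

≃-ext : {A B : Set ℓ} → FunExt ℓ → (e e' : A ≃ B)
      → ((x : A) → proj₁ e x ≡ proj₁ e' x) → e ≡ e'
≃-ext fe (f , p) (f' , p') h = go (fe h) p'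
  where
  go : (r : f ≡ f') (p'' : isEquiv f') → (f , p) ≡ (f' , p'')
  go refl p'' = cong (f ,_) (isProp-isEquiv fe f p p'')

_∘≃_ : {A B C : Set ℓ} → B ≃ C → A ≃ B → A ≃ C
_∘≃_ {A = A} {B = B} {C = C} (g , eg) (f , ef) = (λ x → g (f x)) , eqv
  where
  eqv : isEquiv (λ x → g (f x))
  eqv z = ctr , contr
    where
    mk : (w : fiber g z) → fiber f (proj₁ w) → fiber (λ x → g (f x)) z
    mk (y , s) (x , t) = x , trans (cong g t) s
    c : fiber g z → fiber (λ x → g (f x)) z
    c w = mk w (proj₁ (ef (proj₁ w)))
    D : (w w' : fiber g z) → w ≡ w' → c w ≡ c w'
    D w .w refl = refl
    ctr : fiber (λ x → g (f x)) z
    ctr = c (proj₁ (eg z))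
    contr : (w : fiber (λ x → g (f x)) z) → ctr ≡ w
    contr (x , r) = trans (D _ _ (proj₂ (eg z) (f x , r)))
                          (cong (mk (f x , r)) (proj₂ (ef (f x)) (x , refl)))

record Group (ℓ : Level) : Set (lsuc ℓ) where
  field
    Carrier  : Set ℓ
    isSetCar : isSet Carrier
    _·_      : Carrier → Carrier → Carrier
    e        : Carrier
    inv      : Carrier → Carrier
    assoc    : (x y z : Carrier) → (x · y) · z ≡ x · (y · z)
    idˡ      : (x : Carrier) → e · x ≡ x
    idʳ      : (x : Carrier) → x · e ≡ x
    invˡ     : (x : Carrier) → inv x · x ≡ e
    invʳ     : (x : Carrier) → x · inv x ≡ e

HSet : (ℓ : Level) → Set (lsuc ℓ)
HSet ℓ = Σ (Set ℓ) isSet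

⟨_⟩ : HSet ℓ → Set ℓ
⟨ A ⟩ = proj₁ A

Action : Group ℓ → Set ℓ → Set ℓ
Action G A = Σ (Carrier → A ≃ A) λ α →
    ((x y : Carrier) → α (x · y) ≡ (α x ∘≃ α y)) × (α e ≡ idEquiv A)
  where open Group G

GSet : Group ℓ → Set (lsuc ℓ)
GSet {ℓ} G = Σ (HSet ℓ) λ A → Action G ⟨ A ⟩

XSet : (ℓ : Level) → Set ℓ → Set (lsuc ℓ)
XSet ℓ X = Σ (HSet ℓ) λ A → X → ⟨ A ⟩ → ⟨ A ⟩

U : (G : Group ℓ) {X : Set ℓ} → (X → Group.Carrier G) → GSet G → XSet ℓ X
U G γ (A , α , _) = A , λ x → proj₁ (α (γ x))

-- Generation: the extension F(X) → G is surjective.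
-- F(X) is a quotient of words in X ⊎ X⁻¹, so this is stated via words.

module _ (G : Group ℓ) {X : Set ℓ} (γ : X → Group.Carrier G) where
  open Group G

  evalWord : List (Bool × X) → Carrier
  evalWord []                 = e
  evalWord ((true  , x) ∷ w)  = γ x · evalWord w
  evalWord ((false , x) ∷ w)  = inv (γ x) · evalWord w

  Generates : Set (lsuc ℓ)
  Generates = (g : Carrier) → ∥ Σ (List (Bool × X)) (λ w → evalWord w ≡ g) ∥

module _ (fe : FunExt ℓ) (G : Group ℓ) where
  open Group G

  leftMul : Carrier → Carrier ≃ Carrier
  leftMul g = (λ z → g · z) , eqv
    where
    eqv : isEquiv (λ z → g · z)
    eqv y = (inv g · y , ok) , contr
      where
      ok : g · (inv g · y) ≡ y
      ok = trans (sym (assoc g (inv g) y)) (trans (cong (_· y) (invʳ g)) (idˡ y))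
      contr : (w : fiber (λ z → g · z) y) → (inv g · y , ok) ≡ w
      contr (z , r) = go (sym back) r
        where
        back : z ≡ inv g · y
        back = trans (sym (idˡ z)) (trans (cong (_· z) (sym (invˡ g)))
                 (trans (assoc (inv g) g z) (cong (inv g ·_) r)))
        go : {z' : Carrier} (s : inv g · y ≡ z') (r' : g · z' ≡ y)
           → (inv g · y , ok) ≡ (z' , r')
        go refl r' = cong (inv g · y ,_) (isSetCar _ _ ok r')

  P-G : GSet G
  P-G = (Carrier , isSetCar) , leftMul ,
        (λ x y → ≃-ext fe _ _ (λ z → assoc x y z)) ,
        ≃-ext fe _ _ idˡ

GroupIsoΩ : {A : Set a} {B : Set b} (x : A) (y : B) → Set (a ⊔ b)
GroupIsoΩ x y = Σ (x ≡ x → y ≡ y) λ f →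
  isEquiv f × ((p q : x ≡ x) → f (trans p q) ≡ trans (f p) (f q))

{-# OPTIONS --safe #-}
{-# OPTIONS --without-K #-}
-- The forgetful map U is an embedding.  Its fibres are propositions: an
-- action of G on a set is determined by the action of the generators,
-- since the elements on which two actions agree form a subgroup of G,
-- which contains γ(X) and is therefore all of G, and the homomorphism laws
-- of an action are propositions.  An embedding is an equivalence on path
-- spaces, and cong preserves concatenation.
module Submission where

open import Defs
open import Level using (Level; _⊔_)
open import Data.Product using (Σ; _,_; proj₁; proj₂; _×_)
open import Data.List using (List; []; _∷_)
open import Data.Bool using (Bool; true; false)
open import Relation.Binary.PropositionalEquality
  using (_≡_; refl; sym; trans; cong; cong-app; subst; module ≡-Reasoning)
open import Relation.Binary.PropositionalEquality.Properties
  using (trans-symˡ; trans-cong)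

private variable
  a b ℓ : Level

isContr-retract : {A : Set a} {B : Set b} (r : A → B) (s : B → A)
                → ((y : B) → r (s y) ≡ y) → isContr A → isContr B
isContr-retract r s rs (c , h) = r c , λ y → trans (cong r (h (s y))) (rs y)

isProp-retract : {A : Set a} {B : Set b} (r : A → B) (s : B → A)
               → ((y : B) → r (s y) ≡ y) → isProp A → isProp B
isProp-retract r s rs pA x y =
  trans (sym (rs x)) (trans (cong r (pA (s x) (s y))) (rs y))

isProp→isContr-≡ : {A : Set a} → isProp A → (x y : A) → isContr (x ≡ y)
isProp→isContr-≡ p x y = p x y , isProp→isSet p x y (p x y)

isProp-× : {A : Set a} {B : Set b} → isProp A → isProp B → isProp (A × B)
isProp-× pA pB (x , y) (x' , y') = go (pA x x') (pB y y')
  where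
  go : x ≡ x' → y ≡ y' → (x , y) ≡ (x' , y')
  go refl refl = refl

Σ-≡-prop : {A : Set a} {P : A → Set b} → ((x : A) → isProp (P x))
         → (u v : Σ A P) → proj₁ u ≡ proj₁ v → u ≡ v
Σ-≡-prop pP (x , p) (.x , p') refl = cong (x ,_) (pP x p p')

-- decode need not invert encode: prefixed by (decode (encode refl))⁻¹ it
-- becomes a left inverse of encode, by path induction.
isProp-≡-retract : {A : Set a} {C : A → Set b} {u : A}
                   (encode : ∀ {v} → u ≡ v → C v) (decode : ∀ {v} → C v → u ≡ v)
                 → ((v : A) → isProp (C v)) → (v : A) → isProp (u ≡ v)
isProp-≡-retract {C = C} {u = u} encode decode pC v =
  isProp-retract normalise encode normalise-encode (pC v)
  where
  normalise : ∀ {v} → C v → u ≡ v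
  normalise c = trans (sym (decode (encode refl))) (decode c)
  normalise-encode : ∀ {v} (p : u ≡ v) → normalise (encode p) ≡ p
  normalise-encode refl = trans-symˡ (decode (encode refl))

isSet-Σ : {A : Set a} {P : A → Set b} → isSet A → ((x : A) → isProp (P x))
        → isSet (Σ A P)
isSet-Σ sA pP u = isProp-≡-retract (cong proj₁) (Σ-≡-prop pP u _) (λ v → sA _ _)

module _ (fe : FunExt ℓ) where

  isProp-Π : {A : Set ℓ} {B : A → Set ℓ} → ((x : A) → isProp (B x))
           → isProp ((x : A) → B x)
  isProp-Π pB f g = fe (λ x → pB x (f x) (g x))

  isSet-Π : {A : Set ℓ} {B : A → Set ℓ} → ((x : A) → isSet (B x))
          → isSet ((x : A) → B x)
  isSet-Π sB f = isProp-≡-retract cong-app fe (λ g → isProp-Π (λ x → sB x _ _))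

  isSet-≃ : {A : Set ℓ} → isSet A → isSet (A ≃ A)
  isSet-≃ sA = isSet-Σ (isSet-Π (λ _ → sA)) (isProp-isEquiv fe)

hasPropFibres : {A : Set a} {B : Set b} → (A → B) → Set _
hasPropFibres {B = B} f = (y : B) → isProp (fiber f y)

isEmbedding : {A : Set a} {B : Set b} → (A → B) → Set _
isEmbedding {A = A} f = (x x' : A) → isEquiv (cong f {x} {x'})

injective→hasPropFibres : {A : Set a} {B : Set b} {f : A → B} → isSet B
                        → ((x x' : A) → f x ≡ f x' → x ≡ x') → hasPropFibres f
injective→hasPropFibres sB inj y (x , p) (x' , p') =
  Σ-≡-prop (λ x → sB _ y) (x , p) (x' , p') (inj x x' (trans p (sym p')))

-- The fibre of cong f over q : f x ≡ f x' is a retract of the path type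
-- (x , q) ≡ (x' , refl) in the proposition fiber f (f x').
hasPropFibres→isEmbedding : {A : Set a} {B : Set b} {f : A → B}
                          → hasPropFibres f → isEmbedding f
hasPropFibres→isEmbedding {f = f} pf x x' q =
  isContr-retract to from to-from (isProp→isContr-≡ (pf (f x')) (x , q) (x' , refl))
  where
  to : ∀ {x x'} {q : f x ≡ f x'} → _≡_ {A = fiber f (f x')} (x , q) (x' , refl)
     → fiber (cong f) q
  to refl = refl , refl
  from : ∀ {x x'} {q : f x ≡ f x'} → fiber (cong f) q
       → _≡_ {A = fiber f (f x')} (x , q) (x' , refl)
  from (refl , refl) = refl
  to-from : ∀ {x x'} {q : f x ≡ f x'} (w : fiber (cong f) q) → to (from w) ≡ w
  to-from (refl , refl) = refl

cong-GroupIsoΩ : {A : Set a} {B : Set b} {f : A → B} → isEmbedding f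
               → (x : A) → GroupIsoΩ x (f x)
cong-GroupIsoΩ {f = f} emb x = cong f , emb x x , λ p q → sym (trans-cong p)

module _ {A : Set a} {P Q : A → Set b} (g : (x : A) → P x → Q x) where

  tot : Σ A P → Σ A Q
  tot (x , u) = x , g x u

  tot-hasPropFibres : ((x : A) → hasPropFibres (g x)) → hasPropFibres tot
  tot-hasPropFibres pg (x , y) = isProp-retract toTot fromTot toTot-fromTot (pg x y)
    where
    fromTot : ∀ {x} {y : Q x} → fiber tot (x , y) → fiber (g x) y
    fromTot ((x' , u) , refl) = u , refl
    toTot : ∀ {x} {y : Q x} → fiber (g x) y → fiber tot (x , y)
    toTot {x} (u , r) = (x , u) , cong (x ,_) r
    toTot-fromTot : ∀ {x} {y : Q x} (w : fiber tot (x , y)) → toTot (fromTot w) ≡ w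
    toTot-fromTot ((x' , u) , refl) = refl

module _ (G : Group ℓ) where
  open Group G

  record IsSubgroup {ℓ′ : Level} (S : Carrier → Set ℓ′) : Set (ℓ ⊔ ℓ′) where
    field
      e-closed   : S e
      ·-closed   : ∀ {g h} → S g → S h → S (g · h)
      inv-closed : ∀ {g} → S g → S (inv g)

  module _ {X : Set ℓ} (γ : X → Carrier) where

    evalWord-closed : {ℓ′ : Level} {S : Carrier → Set ℓ′} → IsSubgroup S
                    → ((x : X) → S (γ x)) → (w : List (Bool × X)) → S (evalWord G γ w)
    evalWord-closed S-sub Sγ []              = IsSubgroup.e-closed S-sub
    evalWord-closed S-sub Sγ ((true  , x) ∷ w) =
      IsSubgroup.·-closed S-sub (Sγ x) (evalWord-closed S-sub Sγ w)
    evalWord-closed S-sub Sγ ((false , x) ∷ w) =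
      IsSubgroup.·-closed S-sub (IsSubgroup.inv-closed S-sub (Sγ x))
                                (evalWord-closed S-sub Sγ w)

    generated-ind : Generates G γ → {S : Carrier → Set ℓ} → ((g : Carrier) → isProp (S g))
                  → IsSubgroup S → ((x : X) → S (γ x)) → (g : Carrier) → S g
    generated-ind gen {S} pS S-sub Sγ g =
      gen g (S g) (pS g) (λ { (w , w≡g) → subst S w≡g (evalWord-closed S-sub Sγ w) })

  module _ {A : Set ℓ} where

    act : Action G A → Carrier → A → A
    act α g = proj₁ (proj₁ α g)

    act-· : (α : Action G A) (g h : Carrier) (z : A)
          → act α (g · h) z ≡ act α g (act α h z)
    act-· α g h z = cong (λ E → proj₁ E z) (proj₁ (proj₂ α) g h)

    act-e : (α : Action G A) (z : A) → act α e z ≡ z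
    act-e α z = cong (λ E → proj₁ E z) (proj₂ (proj₂ α))

    act-invˡ : (α : Action G A) (g : Carrier) (z : A) → act α (inv g) (act α g z) ≡ z
    act-invˡ α g z = begin
      act α (inv g) (act α g z)  ≡⟨ act-· α (inv g) g z ⟨
      act α (inv g · g) z        ≡⟨ cong (λ k → act α k z) (invˡ g) ⟩
      act α e z                  ≡⟨ act-e α z ⟩
      z                          ∎
      where open ≡-Reasoning

    act-invʳ : (α : Action G A) (g : Carrier) (z : A) → act α g (act α (inv g) z) ≡ z
    act-invʳ α g z = begin
      act α g (act α (inv g) z)  ≡⟨ act-· α g (inv g) z ⟨
      act α (g · inv g) z        ≡⟨ cong (λ k → act α k z) (invʳ g) ⟩
      act α e z                  ≡⟨ act-e α z ⟩
      z                          ∎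
      where open ≡-Reasoning

    Agree : Action G A → Action G A → Carrier → Set ℓ
    Agree α α' g = (z : A) → act α g z ≡ act α' g z

    Agree-isSubgroup : (α α' : Action G A) → IsSubgroup (Agree α α')
    Agree-isSubgroup α α' = record
      { e-closed   = λ z → trans (act-e α z) (sym (act-e α' z))
      ; ·-closed   = ·-closed
      ; inv-closed = inv-closed
      }
      where
      open ≡-Reasoning
      ·-closed : ∀ {g h} → Agree α α' g → Agree α α' h → Agree α α' (g · h)
      ·-closed {g} {h} αg≡α'g αh≡α'h z = begin
        act α (g · h) z           ≡⟨ act-· α g h z ⟩
        act α g (act α h z)       ≡⟨ cong (act α g) (αh≡α'h z) ⟩
        act α g (act α' h z)      ≡⟨ αg≡α'g _ ⟩
        act α' g (act α' h z)     ≡⟨ act-· α' g h z ⟨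
        act α' (g · h) z          ∎
      inv-closed : ∀ {g} → Agree α α' g → Agree α α' (inv g)
      inv-closed {g} αg≡α'g z = begin
        act α (inv g) z                             ≡⟨ act-invˡ α' g _ ⟨
        act α' (inv g) (act α' g (act α (inv g) z)) ≡⟨ cong (act α' (inv g)) (αg≡α'g _) ⟨
        act α' (inv g) (act α g (act α (inv g) z))  ≡⟨ cong (act α' (inv g)) (act-invʳ α g z) ⟩
        act α' (inv g) z                            ∎

    Action-≡ : FunExt ℓ → isSet A → (α α' : Action G A)
             → ((g : Carrier) → Agree α α' g) → α ≡ α'
    Action-≡ fe sA α α' agree =
      Σ-≡-prop isProp-homLaws α α' (fe (λ g → ≃-ext fe _ _ (agree g)))
      where
      isProp-homLaws : (m : Carrier → A ≃ A)
        → isProp (((x y : Carrier) → m (x · y) ≡ (m x ∘≃ m y)) × (m e ≡ idEquiv A))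
      isProp-homLaws m = isProp-× (isProp-Π fe (λ x → isProp-Π fe (λ y → isSet-≃ fe sA _ _)))
                                  (isSet-≃ fe sA _ _)

  module _ {X : Set ℓ} (γ : X → Carrier) where

    restrict : {A : Set ℓ} → Action G A → X → A → A
    restrict α x = act α (γ x)

    restrict-injective : FunExt ℓ → Generates G γ → {A : Set ℓ} → isSet A
                       → (α α' : Action G A) → restrict α ≡ restrict α' → α ≡ α'
    restrict-injective fe gen sA α α' r =
      Action-≡ fe sA α α'
        (generated-ind γ gen (λ g → isProp-Π fe (λ z → sA _ _)) (Agree-isSubgroup α α')
          (λ x → cong-app (cong-app r x)))

    U-isEmbedding : FunExt ℓ → Generates G γ → isEmbedding (U G γ)
    U-isEmbedding fe gen =
      hasPropFibres→isEmbedding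
        (tot-hasPropFibres (λ (A : HSet ℓ) → restrict {⟨ A ⟩})
          (λ (A , sA) → injective→hasPropFibres
             (isSet-Π fe (λ _ → isSet-Π fe (λ _ → sA))) (restrict-injective fe gen sA)))

mainTheorem4 : {ℓ : Level} (ua : Univalence ℓ) (fe : FunExt ℓ)
               (G : Group ℓ) (X : Set ℓ) (isSetX : isSet X)
               (γ : X → Group.Carrier G) → Generates G γ
               → GroupIsoΩ (P-G fe G) (U G γ (P-G fe G))
mainTheorem4 _ fe G _ _ γ gen = cong-GroupIsoΩ (U-isEmbedding G γ fe gen) (P-G fe G)
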